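{- Let $\mathcal T$ be a subsequential, complete, strongly connected, aperiodic transducer. Then the asymptotic variance $v_2$ of the output sum is zero if and only if the output sum is quasi-deterministic.
   Context: A transducer consists of a finite set of states $\{1,\dots,S\}$, a finite input alphabet $\mathcal A_I\subseteq\mathbb R$ (with at least two elements), an output alphabet $\mathcal A_O\subseteq\mathbb R$, a set of transitions $\mathcal E\subseteq\{1,\dots,S\}^2\times\mathcal A_I$, output labels $\delta\colon\mathcal E\to\mathcal A_O$, and the initial state $1$. A transition $e=(s,t,\varepsilon)$ goes from $s$ to $t$ and has input label $\varepsilon$ and output label $\delta(e)$. The underlying graph is the directed multigraph (loops and parallel edges allowed) whose vertices are the states and whose edges are the transitions. The transducer is deterministic if for every state $s$ and $\varepsilon\in\mathcal A_I$ there is at most one $t$ with $(s,t,\varepsilon)\in\mathcal E$; complete if for every $s$ and $\varepsilon$ there is some such $t$; subsequential if it is deterministic, every state is final, and it has a final output $a\colon\{1,\dots,S\}\to\mathcal A_O$. It is strongly connected and aperiodic if its underlying graph is strongly connected and the gcd of the lengths of all closed walks starting and ending at a given vertex is $1$. The output of the transducer on an input word is the sequence of output labels along the unique path starting at state $1$ whose input labels are the word (read in a fixed direction, from right to left), together with the final output label of the last state of this path. $X_n$ is uniformly distributed on $\mathcal A_I^n$ and $\mathsf{Output}(X_n)$ is the sum of its output sequence. There is a constant $v_2$ with $\mathbb V(\mathsf{Output}(X_n))=v_2n+\mathcal O(1)$; it is called the asymptotic variance of the output sum. The output sum is quasi-deterministic if there is a constant $k\in\mathbb R$ such that $\mathsf{Output}(X_n)=kn+\mathcal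 O(1)$ holds for all $n$ and all inputs, i.e. the difference $\mathsf{Output}(w)-kn$ is bounded uniformly over all $n$ and all words $w\in\mathcal A_I^n$. -}

module Defs where

open import Level using (0ℓ) renaming (suc to lsuc)
open import Algebra.Bundles using (CommutativeRing)
open import Algebra.Structures using (IsCommutativeRing)
import Algebra.Construct.NaturalChoice.Max as Max
open import Data.Bool.Base using (Bool; T)
open import Data.Fin.Base using (Fin; zero)
import Data.Fin.Subset as Subset
open import Data.List.Base using (List; []; _∷_; map; foldr; allFin; cartesianProductWith)
open import Data.Nat.Base as ℕ using (ℕ; zero; suc)
open import Data.Nat.Divisibility using (_∣_)
open import Data.Product.Base using (Σ; ∃; _×_; _,_; proj₁; proj₂)
open import Data.Vec.Base as Vec using (Vec)
open import Relation.Binary.Bundles using (DecTotalOrder)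
open import Relation.Binary.Core using (Rel)
open import Relation.Binary.Definitions using (_Respects_)
open import Relation.Binary.PropositionalEquality.Core using (_≡_)
open import Relation.Binary.Structures using (IsDecTotalOrder)
open import Relation.Nullary.Negation.Core using (¬_)
open import Relation.Unary using (Pred; Satisfiable; _∈_)

-- The classical real numbers, characterised up to isomorphism as a complete
-- (Dedekind) ordered field.  Decidability of the order is the trichotomy of
-- classical analysis.  The inverse is total, with 0# ⁻¹ left unspecified.

record RealField : Set₁ where
  infix  8 _⁻¹
  infix  8 -_
  infixl 7 _*_
  infixl 6 _+_ _-_
  infix  4 _≈_ _≤_

  field
    Carrier           : Set
    _≈_ _≤_           : Rel Carrier 0ℓ
    _+_ _*_           : Carrier → Carrier → Carrier
    -_ _⁻¹            : Carrier → Carrier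
    0# 1#             : Carrier
    isCommutativeRing : IsCommutativeRing _≈_ _+_ _*_ -_ 0# 1#
    isDecTotalOrder   : IsDecTotalOrder _≈_ _≤_
    0≉1               : ¬ (0# ≈ 1#)
    *-inverseʳ        : ∀ {x} → ¬ (x ≈ 0#) → x * x ⁻¹ ≈ 1#
    +-monoˡ-≤         : ∀ {x y} z → x ≤ y → x + z ≤ y + z
    *-nonNegative     : ∀ {x y} → 0# ≤ x → 0# ≤ y → 0# ≤ x * y

  IsUpperBound : Pred Carrier 0ℓ → Carrier → Set
  IsUpperBound P b = ∀ x → x ∈ P → x ≤ b

  field
    supremum : (P : Pred Carrier 0ℓ) → Satisfiable P → ∃ (IsUpperBound P) →
               Σ Carrier λ b → IsUpperBound P b × (∀ c → IsUpperBound P c → b ≤ c)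

  commutativeRing : CommutativeRing 0ℓ 0ℓ
  commutativeRing = record { isCommutativeRing = isCommutativeRing }

  decTotalOrder : DecTotalOrder 0ℓ 0ℓ 0ℓ
  decTotalOrder = record { isDecTotalOrder = isDecTotalOrder }

  open Max (DecTotalOrder.totalOrder decTotalOrder) public using (_⊔_)

  _-_ : Carrier → Carrier → Carrier
  x - y = x + (- y)

  ∣_∣ : Carrier → Carrier
  ∣ x ∣ = x ⊔ (- x)

  fromℕ : ℕ → Carrier
  fromℕ zero    = 0#
  fromℕ (suc n) = 1# + fromℕ n

  sum : List Carrier → Carrier
  sum = foldr _+_ 0#

-- The greatest common divisor of a possibly infinite set of natural numbers.

IsGCD : Pred ℕ 0ℓ → ℕ → Set
IsGCD P g = (∀ n → n ∈ P → g ∣ n) × (∀ d → (∀ n → n ∈ P → d ∣ n) → d ∣ g)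

-- The states 1, …, S are the elements of Fin (suc pred-S), with the initial
-- state 1 represented by zero.  The input alphabet is given by an enumeration
-- without repetition of its q elements, and words and transitions refer to a
-- letter by its index.  The transition set is Boolean-valued so that membership
-- in it carries no information on which δ could depend.

record Transducer (𝓡 : RealField) : Set₁ where
  open RealField 𝓡 using (Carrier; _≈_)

  field
    pred-S           : ℕ
    q                : ℕ
    2≤q              : 2 ℕ.≤ q
    letter           : Fin q → Carrier
    letter-injective : ∀ {i j} → letter i ≈ letter j → i ≡ j
    A-O              : Pred Carrier 0ℓ
    A-O-resp-≈       : A-O Respects _≈_

  State : Set
  State = Fin (suc pred-S)

  initial : State
  initial = zero

  Word : ℕ → Set
  Word = Vec (Fin q)

  field
    E     : State → State → Fin q → Bool
    δ     : ∀ s t ε → T (E s t ε) → Carrier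
    δ∈A-O : ∀ s t ε (e : T (E s t ε)) → δ s t ε e ∈ A-O
    final : Subset.Subset (suc pred-S)

  -- Directed walks in the underlying multigraph, indexed by their length.
  data Walk : State → State → ℕ → Set where
    []  : ∀ {s} → Walk s s 0
    _∷_ : ∀ {s t u ε n} → T (E s t ε) → Walk t u n → Walk s u (suc n)

  StronglyConnected : Set
  StronglyConnected = ∀ s t → ∃ λ n → Walk s t n

  Aperiodic : Set
  Aperiodic = ∀ s → IsGCD (Walk s s) 1

  Deterministic : Set
  Deterministic = ∀ s ε t t′ → T (E s t ε) → T (E s t′ ε) → t ≡ t′

  Complete : Set
  Complete = ∀ s ε → ∃ λ t → T (E s t ε)

  record Subsequential : Set where
    field
      deterministic : Deterministic
      allFinal      : ∀ s → s Subset.∈ final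
      a             : State → Carrier
      a∈A-O         : ∀ s → a s ∈ A-O

module _ {𝓡 : RealField} (𝓣 : Transducer 𝓡)
         (subsequential : Transducer.Subsequential 𝓣)
         (complete : Transducer.Complete 𝓣) where

  open RealField 𝓡
  open Transducer 𝓣 hiding (Walk; []; _∷_)
  open Subsequential subsequential using (a)

  -- Paths from the initial state whose input labels, read from right to left,
  -- form the given word.
  data Path : ∀ {n} → Word n → State → Set where
    start : Path Vec.[] initial
    step  : ∀ {n} {w : Word n} {s} → Path w s →
            ∀ {ε} t → T (E s t ε) → Path (ε Vec.∷ w) t

  outputLabels : ∀ {n} {w : Word n} {s} → Path w s → List Carrier
  outputLabels start                    = []
  outputLabels (step {s = s} p {ε} t e) = δ s t ε e ∷ outputLabels p

  -- Existence comes from completeness; uniqueness of this path is determinism.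
  path : ∀ {n} (w : Word n) → ∃ (Path w)
  path Vec.[]      = initial , start
  path (ε Vec.∷ w) with path w
  ... | s , p with complete s ε
  ...   | t , e = t , step p t e

  outputSequence : ∀ {n} → Word n → List Carrier
  outputSequence w = a (proj₁ (path w)) ∷ outputLabels (proj₂ (path w))

  Output : ∀ {n} → Word n → Carrier
  Output w = sum (outputSequence w)

  allWords : ∀ n → List (Word n)
  allWords zero    = Vec.[] ∷ []
  allWords (suc n) = cartesianProductWith Vec._∷_ (allFin q) (allWords n)

  -- Expectation and variance of f (Xₙ) for Xₙ uniformly distributed on words.
  𝔼 : ∀ {n} → (Word n → Carrier) → Carrier
  𝔼 {n} f = sum (map f (allWords n)) * fromℕ (q ℕ.^ n) ⁻¹

  𝕍 : ∀ {n} → (Word n → Carrier) → Carrier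
  𝕍 f = 𝔼 λ w → (f w - 𝔼 f) * (f w - 𝔼 f)

  IsAsymptoticVariance : Carrier → Set
  IsAsymptoticVariance v₂ =
    ∃ λ C → ∀ n → ∣ 𝕍 (Output {n}) - v₂ * fromℕ n ∣ ≤ C

  QuasiDeterministic : Set
  QuasiDeterministic =
    ∃ λ k → ∃ λ C → ∀ n (w : Word n) → ∣ Output w - k * fromℕ n ∣ ≤ C

{-# OPTIONS --safe #-}
module Submission where

-- Let M n s c be the second moment about c of the output of a random word of
-- length n read from the state s, so that the variance is M n about the mean.
-- M n s is a quadratic function of c with leading coefficient 1, hence
-- M n s (c + h) + M n s (c − h) = 2 M n s c + 2 h².  A lower bound for M n over
-- all states and all c persists for larger n, and if two closed walks of equal
-- length at the initial state differ by h in output, then by the parallelogram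
-- identity one of them pushes the bound up by a positive multiple of h².  By
-- strong connectivity this improvement reaches all states within a bounded
-- number of steps and can be repeated, so a bounded variance forces h = 0.
-- Then the output of a closed walk is proportional to its length, and every
-- path is closed up by one of finitely many return walks.  Conversely, a
-- bounded deviation from kn bounds the variance.

open import Defs
open import Function.Bundles using (_⇔_; mk⇔)
open import Algebra.Bundles using (CommutativeRing; RawRing)
import Algebra.Construct.NaturalChoice.Max as Max
import Algebra.Solver.Ring as RingSolver
open import Algebra.Solver.Ring.AlmostCommutativeRing using (fromCommutativeRing; _-Raw-AlmostCommutative⟶_)
open import Data.Fin.Base using (Fin; zero; suc; fromℕ<)
open import Data.List.Base using (List; []; _∷_; _++_; map; length; cartesianProductWith; allFin; tabulate; reverse)
open import Data.List.Membership.Propositional using (_∈_)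
open import Data.List.Membership.Propositional.Properties using (∈-allFin)
open import Data.List.Properties using (length-++; length-map; length-tabulate; length-reverse; unfold-reverse)
open import Data.List.Relation.Unary.All.Properties using (tabulate⁻)
open import Data.List.Relation.Unary.Any using (here; there)
open import Data.Maybe.Base using (Maybe; just; nothing)
open import Data.Nat.Base as ℕ using (ℕ; zero; suc)
import Data.Nat.Properties as ℕ
open import Data.Nat.Tactic.RingSolver using (solve-∀)
open import Data.Product.Base using (∃; _×_; _,_; proj₁; proj₂)
open import Data.Sum.Base using (_⊎_; inj₁; inj₂)
import Data.Vec.Base as Vec
import Data.Vec.Properties as Vec
open import Relation.Binary.Bundles using (DecTotalOrder; TotalOrder)
open import Relation.Binary.PropositionalEquality as ≡ using (_≡_)
open import Relation.Nullary using (¬_; yes; no; contradiction)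

-- Ring identities are normalised with integer coefficients, the pair (m , n)
-- standing for m − n.
module IntegerCoefficients {c ℓ} (R : CommutativeRing c ℓ) where
  open CommutativeRing R
  open import Algebra.Properties.Ring ring
  open import Algebra.Properties.Semiring.Mult semiring using (×-homo-+; ×1-homo-*) renaming (_×_ to _·_)
  open import Algebra.Properties.CommutativeSemigroup +-commutativeSemigroup using (interchange)
  open import Relation.Binary.Reasoning.Setoid setoid

  -- Pairs are not reduced, so one integer has many representatives. They are identified only
  -- through their images, by `_≟_`.
  differences : RawRing _ _
  differences = record
    { Carrier = ℕ × ℕ
    ; _≈_     = _≡_
    ; _+_     = λ (a , b) (c , d) → a ℕ.+ c , b ℕ.+ d
    ; _*_     = λ (a , b) (c , d) → a ℕ.* c ℕ.+ b ℕ.* d , a ℕ.* d ℕ.+ b ℕ.* c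
    ; -_      = λ (a , b) → b , a
    ; 0#      = 0 , 0
    ; 1#      = 1 , 0
    }

  ⟦_⟧ : ℕ × ℕ → Carrier
  ⟦ a , b ⟧ = a · 1# - b · 1#

  +-minus-interchange : ∀ w x y z → (w + x) - (y + z) ≈ (w - y) + (x - z)
  +-minus-interchange w x y z = begin
    (w + x) - (y + z)     ≈⟨ +-congˡ (-‿+-comm y z) ⟨
    (w + x) + (- y - z)   ≈⟨ interchange w x (- y) (- z) ⟩
    (w - y) + (x - z)     ∎

  *-minus : ∀ w x y z → (w * y + x * z) - (w * z + x * y) ≈ (w - x) * (y - z)
  *-minus w x y z = begin
    (w * y + x * z) - (w * z + x * y)      ≈⟨ +-minus-interchange _ _ _ _ ⟩
    (w * y - w * z) + (x * z - x * y)      ≈⟨ +-cong (sym (x[y-z]≈xy-xz w y z)) (sym (x[y-z]≈xy-xz x z y)) ⟩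
    w * (y - z) + x * (z - y)              ≈⟨ +-congˡ (*-congˡ (+-congʳ (-‿involutive z))) ⟨
    w * (y - z) + x * (- (- z) - y)        ≈⟨ +-congˡ (*-congˡ (trans (-‿+-comm (- z) y) (-‿cong (+-comm (- z) y)))) ⟩
    w * (y - z) + x * - (y - z)            ≈⟨ +-congˡ (-‿distribʳ-* x (y - z)) ⟨
    w * (y - z) - x * (y - z)              ≈⟨ [y-z]x≈yx-zx (y - z) w x ⟨
    (w - x) * (y - z)                      ∎

  morphism : differences -Raw-AlmostCommutative⟶ fromCommutativeRing R
  morphism = record
    { ⟦_⟧    = ⟦_⟧
    ; +-homo = λ (a , b) (c , d) → trans
        (+-cong (×-homo-+ 1# a c) (-‿cong (×-homo-+ 1# b d)))
        (+-minus-interchange _ _ _ _)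
    ; *-homo = λ (a , b) (c , d) → trans
        (+-cong (products a c b d) (-‿cong (products a d b c)))
        (*-minus _ _ _ _)
    ; -‿homo = λ (a , b) → begin
        b · 1# - a · 1#           ≈⟨ +-congʳ (-‿involutive _) ⟨
        - (- (b · 1#)) - a · 1#   ≈⟨ trans (-‿+-comm _ _) (-‿cong (+-comm _ _)) ⟩
        - (a · 1# - b · 1#)       ∎
    ; 0-homo = -‿inverseʳ 0#
    ; 1-homo = trans (+-congˡ -0#≈0#) (trans (+-identityʳ _) (+-identityʳ 1#))
    }
    where
    products : ∀ a b c d → (a ℕ.* b ℕ.+ c ℕ.* d) · 1# ≈ a · 1# * b · 1# + c · 1# * d · 1#
    products a b c d = trans (×-homo-+ 1# (a ℕ.* b) (c ℕ.* d)) (+-cong (×1-homo-* a b) (×1-homo-* c d))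

  cross : ∀ {w x y z} → w + z ≈ y + x → w - x ≈ y - z
  cross {w} {x} {y} {z} w+z≈y+x = begin
    w - x                    ≈⟨ +-identityʳ _ ⟨
    (w - x) + 0#             ≈⟨ +-congˡ (-‿inverseʳ z) ⟨
    (w - x) + (z - z)        ≈⟨ interchange w (- x) z (- z) ⟩
    (w + z) + (- x - z)      ≈⟨ +-congʳ w+z≈y+x ⟩
    (y + x) + (- x - z)      ≈⟨ interchange y x (- x) (- z) ⟩
    (y - x) + (x - z)        ≈⟨ interchange y (- x) x (- z) ⟩
    (y + x) + (- x - z)      ≈⟨ +-congˡ (+-comm _ _) ⟩
    (y + x) + (- z - x)      ≈⟨ interchange y x (- z) (- x) ⟩
    (y - z) + (x - x)        ≈⟨ +-congˡ (-‿inverseʳ x) ⟩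
    (y - z) + 0#             ≈⟨ +-identityʳ _ ⟩
    y - z                    ∎

  -- Equality of the integers is tested without subtraction, as `a + d = c + b`. A failed test does
  -- not separate the images, since the ring may have positive characteristic.
  _≟_ : ∀ p q → Maybe (⟦ p ⟧ ≈ ⟦ q ⟧)
  (a , b) ≟ (c , d) with a ℕ.+ d ℕ.≟ c ℕ.+ b
  ... | no  _  = nothing
  ... | yes eq = just (cross (begin
    a · 1# + d · 1#   ≈⟨ ×-homo-+ 1# a d ⟨
    (a ℕ.+ d) · 1#    ≡⟨ ≡.cong (_· 1#) eq ⟩
    (c ℕ.+ b) · 1#    ≈⟨ ×-homo-+ 1# c b ⟩
    c · 1# + b · 1#   ∎))

  open RingSolver differences (fromCommutativeRing R) morphism _≟_ public
    using (solve; _:=_; _:+_; _:*_; _:-_; :-_; con)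

-- The value `f zero` seeds the maximum, because a total order need not have a least element. The
-- order is arbitrary because both lengths of return walks and real deviations get bounded.
finite-bound : ∀ {c ℓ₁ ℓ₂} (O : TotalOrder c ℓ₁ ℓ₂) {n} (f : Fin (suc n) → TotalOrder.Carrier O) →
               ∃ λ b → ∀ i → TotalOrder._≤_ O (f i) b
finite-bound O f = max (f zero) (tabulate f) , tabulate⁻ (xs≤max (f zero) (tabulate f))
  where open import Data.List.Extrema O using (max; xs≤max)

-- Ordered-field arithmetic and the Archimedean property.

module RealFieldProperties (𝓡 : RealField) where
  open RealField 𝓡
  open CommutativeRing commutativeRing public
    using (setoid; refl; sym; trans; reflexive; +-cong; +-congˡ; +-congʳ; +-comm; +-assoc; +-identityˡ; +-identityʳ;
           -‿cong; -‿inverseʳ; *-cong; *-congˡ; *-congʳ; *-comm; *-assoc; *-identityˡ; *-identityʳ; zeroˡ; zeroʳ; distribˡ; distribʳ)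
  open import Algebra.Properties.Ring (CommutativeRing.ring commutativeRing) public using (-0#≈0#; -‿involutive)
  open DecTotalOrder decTotalOrder public
    using (poset; total; ≤-respˡ-≈; ≤-respʳ-≈; antisym; _≟_)
    renaming (totalOrder to ≤-totalOrder; refl to ≤-refl; trans to ≤-trans; reflexive to ≤-reflexive)
  open IntegerCoefficients commutativeRing public using (solve; _:=_; _:+_; _:*_; _:-_; :-_; con)

  open Max ≤-totalOrder public using (x≤x⊔y; x≤y⊔x; ⊔-cong)

  -- The standard form of the inequalities below: a nonnegative `d` is assembled from the
  -- hypotheses, and a ring identity remains for the solver.
  ≤-by-difference : ∀ {x y d} → 0# ≤ d → d + x ≈ y → x ≤ y
  ≤-by-difference {x} 0≤d d+x≈y = ≤-respʳ-≈ d+x≈y (≤-respˡ-≈ (+-identityˡ x) (+-monoˡ-≤ x 0≤d))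

  difference-nonNegative : ∀ {x y} → x ≤ y → 0# ≤ y - x
  difference-nonNegative {x} x≤y = ≤-respˡ-≈ (-‿inverseʳ x) (+-monoˡ-≤ (- x) x≤y)

  +-mono-≤ : ∀ {x y u v} → x ≤ y → u ≤ v → x + u ≤ y + v
  +-mono-≤ {x} {y} {u} {v} x≤y u≤v = ≤-trans (+-monoˡ-≤ u x≤y)
    (≤-respˡ-≈ (+-comm u y) (≤-respʳ-≈ (+-comm v y) (+-monoˡ-≤ y u≤v)))

  +-monoʳ-≤ : ∀ x {u v} → u ≤ v → x + u ≤ x + v
  +-monoʳ-≤ x = +-mono-≤ ≤-refl

  +-nonNegative : ∀ {x y} → 0# ≤ x → 0# ≤ y → 0# ≤ x + y
  +-nonNegative 0≤x 0≤y = ≤-respˡ-≈ (+-identityˡ 0#) (+-mono-≤ 0≤x 0≤y)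

  neg-anti-≤ : ∀ {x y} → x ≤ y → - y ≤ - x
  neg-anti-≤ {x} {y} x≤y = ≤-by-difference (difference-nonNegative x≤y)
    (solve 2 (λ x y → (y :- x) :+ (:- y) := :- x) refl x y)

  neg-nonNegative : ∀ {x} → x ≤ 0# → 0# ≤ - x
  neg-nonNegative {x} x≤0 = ≤-respʳ-≈ (+-identityˡ (- x)) (difference-nonNegative x≤0)

  *-monoʳ-≤ : ∀ {z x y} → 0# ≤ z → x ≤ y → x * z ≤ y * z
  *-monoʳ-≤ {z} {x} {y} 0≤z x≤y = ≤-by-difference (*-nonNegative (difference-nonNegative x≤y) 0≤z)
    (solve 3 (λ x y z → (y :- x) :* z :+ x :* z := y :* z) refl x y z)

  square-nonNegative : ∀ x → 0# ≤ x * x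
  square-nonNegative x with total 0# x
  ... | inj₁ 0≤x = *-nonNegative 0≤x 0≤x
  ... | inj₂ x≤0 = ≤-respʳ-≈ (solve 1 (λ x → (:- x) :* (:- x) := x :* x) refl x)
    (*-nonNegative (neg-nonNegative x≤0) (neg-nonNegative x≤0))

  0≤1 : 0# ≤ 1#
  0≤1 = ≤-respʳ-≈ (*-identityˡ 1#) (square-nonNegative 1#)

  *-inverseˡ : ∀ {x} → ¬ (x ≈ 0#) → x ⁻¹ * x ≈ 1#
  *-inverseˡ x≉0 = trans (*-comm _ _) (*-inverseʳ x≉0)

  ⁻¹-nonNegative : ∀ {x} → 0# ≤ x → ¬ (x ≈ 0#) → 0# ≤ x ⁻¹
  ⁻¹-nonNegative {x} 0≤x x≉0 with total 0# (x ⁻¹)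
  ... | inj₁ 0≤x⁻¹ = 0≤x⁻¹
  ... | inj₂ x⁻¹≤0 = contradiction (antisym 0≤1 1≤0) 0≉1
    where
    1≤0 : 1# ≤ 0#
    -- The product `x * (- x ⁻¹)` is nonnegative and equals minus one.
    1≤0 = ≤-by-difference (*-nonNegative 0≤x (neg-nonNegative x⁻¹≤0))
      (trans (+-congˡ (sym (*-inverseʳ x≉0)))
        -- The constant `con (0 , 0)` evaluates to `0# - 0#`, which the final `-‿inverseʳ` turns
        -- into `0#`.
        (trans (solve 2 (λ x y → x :* (:- y) :+ x :* y := con (0 , 0)) refl x (x ⁻¹)) (-‿inverseʳ 0#)))

  *-cancelʳ-≈ : ∀ {x y z} → ¬ (z ≈ 0#) → x * z ≈ y * z → x ≈ y
  *-cancelʳ-≈ {x} {y} {z} z≉0 xz≈yz = begin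
    x               ≈⟨ undo x ⟩
    x * z * z ⁻¹    ≈⟨ *-congʳ xz≈yz ⟩
    y * z * z ⁻¹    ≈⟨ undo y ⟨
    y               ∎
    where
    open import Relation.Binary.Reasoning.Setoid setoid
    undo : ∀ u → u ≈ u * z * z ⁻¹
    undo u = sym (trans (*-assoc u z (z ⁻¹)) (trans (*-congˡ (*-inverseʳ z≉0)) (*-identityʳ u)))

  x*x≈0⇒x≈0 : ∀ {x} → x * x ≈ 0# → x ≈ 0#
  x*x≈0⇒x≈0 {x} x*x≈0 with x ≟ 0#
  ... | yes x≈0 = x≈0
  ... | no  x≉0 = *-cancelʳ-≈ x≉0 (trans x*x≈0 (sym (zeroˡ x)))

  fromℕ-nonNegative : ∀ n → 0# ≤ fromℕ n
  fromℕ-nonNegative zero    = ≤-refl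
  fromℕ-nonNegative (suc n) = +-nonNegative 0≤1 (fromℕ-nonNegative n)

  1≤fromℕ-suc : ∀ n → 1# ≤ fromℕ (suc n)
  1≤fromℕ-suc n = ≤-by-difference (fromℕ-nonNegative n) (+-comm _ _)

  fromℕ≉0 : ∀ n → .{{ℕ.NonZero n}} → ¬ (fromℕ n ≈ 0#)
  fromℕ≉0 (suc n) 1+n≈0 = 0≉1 (antisym 0≤1 (≤-respʳ-≈ 1+n≈0 (1≤fromℕ-suc n)))

  fromℕ-⁻¹-nonNegative : ∀ n → .{{ℕ.NonZero n}} → 0# ≤ fromℕ n ⁻¹
  fromℕ-⁻¹-nonNegative n = ⁻¹-nonNegative (fromℕ-nonNegative n) (fromℕ≉0 n)

  fromℕ-⁻¹≤1 : ∀ n → .{{ℕ.NonZero n}} → fromℕ n ⁻¹ ≤ 1#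
  fromℕ-⁻¹≤1 n@(suc m) = ≤-respˡ-≈ (*-identityˡ _) (≤-respʳ-≈ (*-inverseʳ (fromℕ≉0 n))
    (*-monoʳ-≤ (fromℕ-⁻¹-nonNegative n) (1≤fromℕ-suc m)))

  fromℕ-+ : ∀ m n → fromℕ (m ℕ.+ n) ≈ fromℕ m + fromℕ n
  fromℕ-+ zero    n = sym (+-identityˡ _)
  fromℕ-+ (suc m) n = trans (+-congˡ (fromℕ-+ m n)) (sym (+-assoc _ _ _))

  fromℕ-* : ∀ m n → fromℕ (m ℕ.* n) ≈ fromℕ m * fromℕ n
  fromℕ-* zero    n = sym (zeroˡ _)
  fromℕ-* (suc m) n = begin
    fromℕ (n ℕ.+ m ℕ.* n)             ≈⟨ fromℕ-+ n (m ℕ.* n) ⟩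
    fromℕ n + fromℕ (m ℕ.* n)         ≈⟨ +-cong (*-identityˡ _) (sym (fromℕ-* m n)) ⟨
    1# * fromℕ n + fromℕ m * fromℕ n  ≈⟨ distribʳ (fromℕ n) 1# (fromℕ m) ⟨
    (1# + fromℕ m) * fromℕ n          ∎
    where open import Relation.Binary.Reasoning.Setoid setoid

  fromℕ-*-⁻¹ : ∀ m n → .{{ℕ.NonZero m}} → .{{ℕ.NonZero n}} → fromℕ (m ℕ.* n) ⁻¹ ≈ fromℕ n ⁻¹ * fromℕ m ⁻¹
  fromℕ-*-⁻¹ m n = *-cancelʳ-≈ (fromℕ≉0 (m ℕ.* n) {{ℕ.m*n≢0 m n}}) (begin
    fromℕ (m ℕ.* n) ⁻¹ * fromℕ (m ℕ.* n)                   ≈⟨ *-inverseˡ (fromℕ≉0 (m ℕ.* n) {{ℕ.m*n≢0 m n}}) ⟩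
    1#                                                     ≈⟨ *-identityˡ 1# ⟨
    1# * 1#                                                ≈⟨ *-cong (*-inverseʳ (fromℕ≉0 m)) (*-inverseʳ (fromℕ≉0 n)) ⟨
    fromℕ m * fromℕ m ⁻¹ * (fromℕ n * fromℕ n ⁻¹)          ≈⟨ solve 4 (λ m u n v → m :* u :* (n :* v) := v :* u :* (m :* n)) refl
                                                                (fromℕ m) (fromℕ m ⁻¹) (fromℕ n) (fromℕ n ⁻¹) ⟩
    fromℕ n ⁻¹ * fromℕ m ⁻¹ * (fromℕ m * fromℕ n)          ≈⟨ *-congˡ (fromℕ-* m n) ⟨
    fromℕ n ⁻¹ * fromℕ m ⁻¹ * fromℕ (m ℕ.* n)              ∎)
    where open import Relation.Binary.Reasoning.Setoid setoid

  -- The natural multiples of `x` have a supremum `s`. Every multiple has a successor below `s`, so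
  -- `s - x` is an upper bound as well. Leastness gives `s ≤ s - x`, hence `x ≤ 0#`.
  archimedean : ∀ {x b} → (∀ n → fromℕ n * x ≤ b) → x ≤ 0#
  archimedean {x} {b} bounded with supremum (λ y → ∃ λ n → y ≈ fromℕ n * x) (_ , 0 , refl)
      (b , λ { y (n , y≈nx) → ≤-respˡ-≈ (sym y≈nx) (bounded n) })
  ... | s , isUpperBound , isLeast = ≤-by-difference
      (difference-nonNegative (isLeast (s - x) λ { y (n , y≈nx) → ≤-by-difference
        (difference-nonNegative (isUpperBound (fromℕ (suc n) * x) (suc n , refl)))
        (trans (+-congˡ y≈nx) (trans (+-congʳ (+-congˡ (-‿cong (trans (*-comm _ _) (distribˡ x 1# (fromℕ n))))))
          (trans (+-congʳ (+-congˡ (-‿cong (+-congʳ (*-identityʳ x)))))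
          (solve 3 (λ x s n → s :- (x :+ x :* n) :+ n :* x := s :- x) refl x s (fromℕ n))))) }))
      (trans (solve 2 (λ x s → s :- x :- s :+ x := con (0 , 0)) refl x s) (-‿inverseʳ 0#))

  -- The larger of two numbers is at least their mean; doubling `x` avoids dividing by two.
  either-≤ : ∀ {x y z} → x + x ≤ y + z → x ≤ y ⊎ x ≤ z
  either-≤ {x} {y} {z} x+x≤y+z with total x y
  ... | inj₁ x≤y = inj₁ x≤y
  ... | inj₂ y≤x = inj₂ (≤-by-difference
    (+-nonNegative (difference-nonNegative x+x≤y+z) (difference-nonNegative y≤x))
    (solve 3 (λ x y z → (y :+ z :- (x :+ x)) :+ (x :- y) :+ x := z) refl x y z))

  square-mono-≤ : ∀ {x y} → x ≤ y → - y ≤ x → x * x ≤ y * y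
  square-mono-≤ {x} {y} x≤y -y≤x = ≤-by-difference
    (*-nonNegative (difference-nonNegative x≤y) (difference-nonNegative -y≤x))
    (solve 2 (λ x y → (y :- x) :* (x :- (:- y)) :+ x :* x := y :* y) refl x y)

  ∣x∣≤c⇒-c≤x : ∀ {x c} → ∣ x ∣ ≤ c → - c ≤ x
  ∣x∣≤c⇒-c≤x {x} ∣x∣≤c = ≤-respʳ-≈ (-‿involutive x) (neg-anti-≤ (≤-trans (x≤y⊔x x (- x)) ∣x∣≤c))

  ∣-∣-cong : ∀ {x y} → x ≈ y → ∣ x ∣ ≈ ∣ y ∣
  ∣-∣-cong x≈y = ⊔-cong x≈y (-‿cong x≈y)

  ∣x∣≤c⇒x≤c : ∀ {x c} → ∣ x ∣ ≤ c → x ≤ c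
  ∣x∣≤c⇒x≤c {x} ∣x∣≤c = ≤-trans (x≤x⊔y x (- x)) ∣x∣≤c

-- Finite sums and averages.

module FiniteAverages (𝓡 : RealField) where
  open RealField 𝓡
  open RealFieldProperties 𝓡
  open import Relation.Binary.Reasoning.PartialOrder poset

  private variable
    A B C : Set
    x y z : Carrier

  ∑ : List A → (A → Carrier) → Carrier
  ∑ xs f = sum (map f xs)

  ∑-cong : ∀ {f g : A → Carrier} xs → (∀ a → f a ≈ g a) → ∑ xs f ≈ ∑ xs g
  ∑-cong []       f≈g = refl
  ∑-cong (a ∷ xs) f≈g = +-cong (f≈g a) (∑-cong xs f≈g)

  ∑-+ : ∀ (f g : A → Carrier) xs → ∑ xs (λ a → f a + g a) ≈ ∑ xs f + ∑ xs g
  ∑-+ f g []       = sym (+-identityˡ 0#)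
  ∑-+ f g (a ∷ xs) = trans (+-congˡ (∑-+ f g xs))
    (solve 4 (λ u v s t → (u :+ v) :+ (s :+ t) := (u :+ s) :+ (v :+ t)) refl (f a) (g a) (∑ xs f) (∑ xs g))

  ∑-*ʳ : ∀ (f : A → Carrier) z xs → ∑ xs (λ a → f a * z) ≈ ∑ xs f * z
  ∑-*ʳ f z []       = sym (zeroˡ z)
  ∑-*ʳ f z (a ∷ xs) = trans (+-congˡ (∑-*ʳ f z xs)) (sym (distribʳ z (f a) (∑ xs f)))

  ∑-const : ∀ z (xs : List A) → ∑ xs (λ _ → z) ≈ fromℕ (length xs) * z
  ∑-const z []       = sym (zeroˡ z)
  ∑-const z (a ∷ xs) = trans (+-cong (sym (*-identityˡ z)) (∑-const z xs)) (sym (distribʳ z 1# _))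

  ∑-swap : ∀ (f : A → B → Carrier) xs ys →
           ∑ xs (λ a → ∑ ys (f a)) ≈ ∑ ys (λ b → ∑ xs (λ a → f a b))
  ∑-swap f []       ys = sym (trans (∑-const 0# ys) (zeroʳ _))
  ∑-swap f (a ∷ xs) ys = trans (+-congˡ (∑-swap f xs ys)) (sym (∑-+ (f a) _ ys))

  ∑-++-map : ∀ (f : B → Carrier) (g : A → B) xs ys → ∑ (map g xs ++ ys) f ≈ ∑ xs (λ a → f (g a)) + ∑ ys f
  ∑-++-map f g []       ys = sym (+-identityˡ _)
  ∑-++-map f g (a ∷ xs) ys = trans (+-congˡ (∑-++-map f g xs ys)) (sym (+-assoc _ _ _))

  ∑-cartesianProductWith : ∀ (f : C → Carrier) (g : A → B → C) xs ys →
    ∑ (cartesianProductWith g xs ys) f ≈ ∑ xs (λ a → ∑ ys (λ b → f (g a b)))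
  ∑-cartesianProductWith f g []       ys = refl
  ∑-cartesianProductWith f g (a ∷ xs) ys =
    trans (∑-++-map f (g a) ys _) (+-congˡ (∑-cartesianProductWith f g xs ys))

  ∑-mono-≤ : ∀ {f g : A → Carrier} xs → (∀ a → f a ≤ g a) → ∑ xs f ≤ ∑ xs g
  ∑-mono-≤ []       f≤g = ≤-refl
  ∑-mono-≤ (a ∷ xs) f≤g = +-mono-≤ (f≤g a) (∑-mono-≤ xs f≤g)

  ∑-mono-≤-gain : ∀ {f g : A → Carrier} {xs a} → (∀ b → f b ≤ g b) →
    a ∈ xs → f a + z ≤ g a → ∑ xs f + z ≤ ∑ xs g
  ∑-mono-≤-gain {f = f} {xs = a ∷ xs} f≤g (here ≡.refl) gain =
    ≤-respˡ-≈ (solve 3 (λ u s z → (u :+ z) :+ s := (u :+ s) :+ z) refl (f a) (∑ xs f) _)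
      (+-mono-≤ gain (∑-mono-≤ xs f≤g))
  ∑-mono-≤-gain {f = f} {xs = b ∷ xs} f≤g (there a∈xs) gain =
    ≤-respˡ-≈ (sym (+-assoc _ _ _)) (+-mono-≤ (f≤g b) (∑-mono-≤-gain f≤g a∈xs gain))

  average : List A → (A → Carrier) → Carrier
  average xs f = ∑ xs f * fromℕ (length xs) ⁻¹

  average-cong : ∀ {f g : A → Carrier} xs → (∀ a → f a ≈ g a) → average xs f ≈ average xs g
  average-cong xs f≈g = *-congʳ (∑-cong xs f≈g)

  average-+ : ∀ (f g : A → Carrier) xs → average xs (λ a → f a + g a) ≈ average xs f + average xs g
  average-+ f g xs = trans (*-congʳ (∑-+ f g xs)) (distribʳ _ _ _)

  average-swap : ∀ (f : A → B → Carrier) xs ys →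
    average xs (λ a → average ys (f a)) ≈ average ys (λ b → average xs (λ a → f a b))
  average-swap f xs ys = begin-equality
    ∑ xs (λ a → ∑ ys (f a) * v) * u          ≈⟨ *-congʳ (∑-*ʳ _ v xs) ⟩
    ∑ xs (λ a → ∑ ys (f a)) * v * u          ≈⟨ *-congʳ (*-congʳ (∑-swap f xs ys)) ⟩
    ∑ ys (λ b → ∑ xs (λ a → f a b)) * v * u  ≈⟨ solve 3 (λ s v u → s :* v :* u := s :* u :* v) refl _ v u ⟩
    ∑ ys (λ b → ∑ xs (λ a → f a b)) * u * v  ≈⟨ *-congʳ (∑-*ʳ _ u ys) ⟨
    ∑ ys (λ b → ∑ xs (λ a → f a b) * u) * v  ∎
    where
    u v : Carrier
    u = fromℕ (length xs) ⁻¹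
    v = fromℕ (length ys) ⁻¹

  length-cartesianProductWith : ∀ (g : A → B → C) xs ys →
    length (cartesianProductWith g xs ys) ≡ length xs ℕ.* length ys
  length-cartesianProductWith g []       ys = ≡.refl
  length-cartesianProductWith g (a ∷ xs) ys =
    ≡.trans (length-++ (map (g a) ys)) (≡.cong₂ ℕ._+_ (length-map (g a) ys) (length-cartesianProductWith g xs ys))

  average-cartesianProductWith : ∀ (f : C → Carrier) (g : A → B → C) xs ys →
    .{{ℕ.NonZero (length xs)}} → .{{ℕ.NonZero (length ys)}} →
    average (cartesianProductWith g xs ys) f ≈ average xs (λ a → average ys (λ b → f (g a b)))
  average-cartesianProductWith f g xs ys = begin-equality
    ∑ (cartesianProductWith g xs ys) f * fromℕ (length (cartesianProductWith g xs ys)) ⁻¹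
      ≈⟨ *-cong (∑-cartesianProductWith f g xs ys)
           (reflexive (≡.cong (λ n → fromℕ n ⁻¹) (length-cartesianProductWith g xs ys))) ⟩
    ∑ xs (λ a → ∑ ys (λ b → f (g a b))) * fromℕ (length xs ℕ.* length ys) ⁻¹
      ≈⟨ *-congˡ (fromℕ-*-⁻¹ (length xs) (length ys)) ⟩
    ∑ xs (λ a → ∑ ys (λ b → f (g a b))) * (fromℕ (length ys) ⁻¹ * fromℕ (length xs) ⁻¹)
      ≈⟨ *-assoc _ _ _ ⟨
    ∑ xs (λ a → ∑ ys (λ b → f (g a b))) * fromℕ (length ys) ⁻¹ * fromℕ (length xs) ⁻¹
      ≈⟨ *-congʳ (∑-*ʳ _ _ xs) ⟨
    average xs (λ a → average ys (λ b → f (g a b)))  ∎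

  average-const : ∀ z (xs : List A) → .{{ℕ.NonZero (length xs)}} → average xs (λ _ → z) ≈ z
  average-const z xs = begin-equality
    ∑ xs (λ _ → z) * u         ≈⟨ *-congʳ (∑-const z xs) ⟩
    fromℕ (length xs) * z * u  ≈⟨ solve 3 (λ n z u → n :* z :* u := z :* (n :* u)) refl _ z u ⟩
    z * (fromℕ (length xs) * u) ≈⟨ *-congˡ (*-inverseʳ (fromℕ≉0 (length xs))) ⟩
    z * 1#                      ≈⟨ *-identityʳ z ⟩
    z                           ∎
    where
    u : Carrier
    u = fromℕ (length xs) ⁻¹

  average-mono-≤ : ∀ {f g : A → Carrier} xs → .{{ℕ.NonZero (length xs)}} →
    (∀ a → f a ≤ g a) → average xs f ≤ average xs g
  average-mono-≤ xs f≤g = *-monoʳ-≤ (fromℕ-⁻¹-nonNegative (length xs)) (∑-mono-≤ xs f≤g)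

  average-≥ : ∀ {f : A → Carrier} xs → .{{ℕ.NonZero (length xs)}} → (∀ a → z ≤ f a) → z ≤ average xs f
  average-≥ xs z≤f = ≤-respˡ-≈ (average-const _ xs) (average-mono-≤ xs z≤f)

  average-≤ : ∀ {f : A → Carrier} xs → .{{ℕ.NonZero (length xs)}} → (∀ a → f a ≤ z) → average xs f ≤ z
  average-≤ xs f≤z = ≤-respʳ-≈ (average-const _ xs) (average-mono-≤ xs f≤z)

  -- A gain at a single entry survives averaging, diluted by the length of the list. This is the
  -- source of each factor `r` in the gains below.
  average-≥-gain : ∀ {f : A → Carrier} {xs a} → .{{ℕ.NonZero (length xs)}} → (∀ b → y ≤ f b) →
    a ∈ xs → y + z ≤ f a → y + z * fromℕ (length xs) ⁻¹ ≤ average xs f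
  average-≥-gain {xs = xs} y≤f a∈xs gain =
    ≤-respˡ-≈ (trans (distribʳ _ _ _) (+-congʳ (average-const _ xs)))
      (*-monoʳ-≤ (fromℕ-⁻¹-nonNegative (length xs)) (∑-mono-≤-gain y≤f a∈xs gain))

module CompleteTransducer {𝓡 : RealField} (𝓣 : Transducer 𝓡)
  (subsequential : Transducer.Subsequential 𝓣) (complete : Transducer.Complete 𝓣) where

  open RealField 𝓡
  open RealFieldProperties 𝓡
  open FiniteAverages 𝓡
  open import Algebra.Properties.Semiring.Exp (CommutativeRing.semiring commutativeRing) using (_^_)
  open Transducer 𝓣 using (State; Word; initial; q; 2≤q; δ; StronglyConnected; Walk; []; _∷_)
  open Transducer.Subsequential subsequential using (a; deterministic)

  -- Runs of the transducer and their outputs.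

  next : State → Fin q → State
  next s ε = proj₁ (complete s ε)

  label : State → Fin q → Carrier
  label s ε = δ s (next s ε) ε (proj₂ (complete s ε))

  run : State → List (Fin q) → State
  run s []      = s
  run s (ε ∷ l) = run (next s ε) l

  out : State → List (Fin q) → Carrier
  out s []      = 0#
  out s (ε ∷ l) = label s ε + out (next s ε) l

  run-++ : ∀ s l l′ → run s (l ++ l′) ≡ run (run s l) l′
  run-++ s []      l′ = ≡.refl
  run-++ s (ε ∷ l) l′ = run-++ (next s ε) l l′

  out-++ : ∀ s l l′ → out s (l ++ l′) ≈ out s l + out (run s l) l′
  out-++ s []      l′ = sym (+-identityˡ _)
  out-++ s (ε ∷ l) l′ = trans (+-congˡ (out-++ (next s ε) l l′)) (sym (+-assoc _ _ _))

  power : ℕ → List (Fin q) → List (Fin q)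
  power zero    l = []
  power (suc j) l = l ++ power j l

  length-power : ∀ j l → length (power j l) ≡ j ℕ.* length l
  length-power zero    l = ≡.refl
  length-power (suc j) l = ≡.trans (length-++ l) (≡.cong (length l ℕ.+_) (length-power j l))

  run-power : ∀ j {s} l → run s l ≡ s → run s (power j l) ≡ s
  run-power zero        l loop = ≡.refl
  run-power (suc j) {s} l loop = ≡.trans (run-++ s l (power j l))
    (≡.trans (≡.cong (λ t → run t (power j l)) loop) (run-power j l loop))

  out-power : ∀ j {s} l → run s l ≡ s → out s (power j l) ≈ fromℕ j * out s l
  out-power zero    {s} l loop = sym (zeroˡ _)
  out-power (suc j) {s} l loop = begin
    out s (l ++ power j l)                  ≈⟨ out-++ s l (power j l) ⟩
    out s l + out (run s l) (power j l)     ≡⟨ ≡.cong (λ t → out s l + out t (power j l)) loop ⟩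
    out s l + out s (power j l)             ≈⟨ +-cong (sym (*-identityˡ _)) (out-power j l loop) ⟩
    1# * out s l + fromℕ j * out s l        ≈⟨ distribʳ (out s l) 1# (fromℕ j) ⟨
    (1# + fromℕ j) * out s l                ∎
    where open import Relation.Binary.Reasoning.Setoid setoid

  -- By determinism, the target of each edge is the successor chosen by completeness for the same
  -- letter, so the input labels of the walk retrace it as a run.
  Walk⇒run : ∀ {s t n} → Walk s t n → ∃ λ l → run s l ≡ t
  Walk⇒run []                                 = [] , ≡.refl
  Walk⇒run (_∷_ {s} {t} {ε = ε} e walk) with deterministic s ε t (next s ε) e (proj₂ (complete s ε))
  ... | ≡.refl with Walk⇒run walk
  ...   | l , run-l≡u = ε ∷ l , run-l≡u

  -- Second moments of the output of a random word.

  letters : List (Fin q)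
  letters = allFin q

  instance
    letters-nonempty : ℕ.NonZero (length letters)
    letters-nonempty = ≡.subst ℕ.NonZero (≡.sym (length-tabulate {n = q} (λ i → i)))
      (ℕ.>-nonZero (ℕ.≤-trans (ℕ.s≤s ℕ.z≤n) 2≤q))

  -- The probability of one letter; `r ^ n` is that of a prescribed word of length `n`.
  r : Carrier
  r = fromℕ (length letters) ⁻¹

  -- The second moment about c of the output of a random word of length n read
  -- from state s.
  M : ℕ → State → Carrier → Carrier
  M zero    s c = (a s - c) * (a s - c)
  M (suc n) s c = average letters λ ε → M n (next s ε) (c - label s ε)

  M-cong : ∀ n s {c c′} → c ≈ c′ → M n s c ≈ M n s c′
  M-cong zero    s c≈c′ = *-cong (+-congˡ (-‿cong c≈c′)) (+-congˡ (-‿cong c≈c′))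
  M-cong (suc n) s c≈c′ = average-cong letters λ ε → M-cong n (next s ε) (+-congʳ c≈c′)

  -- At length zero this is the parallelogram identity for a single square. Averaging over the first
  -- letter preserves it, being linear and fixing the constant `h * h + h * h`.
  M-parallelogram : ∀ n s c h → M n s (c + h) + M n s (c - h) ≈ M n s c + M n s c + (h * h + h * h)
  M-parallelogram zero    s c h = solve 3 (λ x c h →
    (x :- (c :+ h)) :* (x :- (c :+ h)) :+ (x :- (c :- h)) :* (x :- (c :- h))
    := (x :- c) :* (x :- c) :+ (x :- c) :* (x :- c) :+ (h :* h :+ h :* h)) refl (a s) c h
  M-parallelogram (suc n) s c h = begin
    average letters (λ ε → M n (next s ε) (c + h - label s ε)) + average letters (λ ε → M n (next s ε) (c - h - label s ε))
      ≈⟨ average-+ _ _ letters ⟨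
    average letters (λ ε → M n (next s ε) (c + h - label s ε) + M n (next s ε) (c - h - label s ε))
      ≈⟨ average-cong letters (λ ε → trans
           (+-cong (M-cong n _ (solve 3 (λ c h d → c :+ h :- d := c :- d :+ h) refl c h (label s ε)))
                   (M-cong n _ (solve 3 (λ c h d → c :- h :- d := c :- d :- h) refl c h (label s ε))))
           (M-parallelogram n (next s ε) (c - label s ε) h)) ⟩
    average letters (λ ε → M n (next s ε) (c - label s ε) + M n (next s ε) (c - label s ε) + (h * h + h * h))
      ≈⟨ trans (average-+ _ _ letters) (+-cong (average-+ _ _ letters) (average-const _ letters)) ⟩
    M (suc n) s c + M (suc n) s c + (h * h + h * h)  ∎
    where open import Relation.Binary.Reasoning.Setoid setoid

  -- Lower bounds for the second moment and their growth.

  -- The recursion of `M` changes both the state and the centre, so a bound that is to pass through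
  -- it must hold for all of them.
  LowerBound : ℕ → Carrier → Set
  LowerBound n x = ∀ s c → x ≤ M n s c

  LowerBound-zero : LowerBound 0 0#
  LowerBound-zero s c = square-nonNegative (a s - c)

  LowerBound-+ : ∀ k {n x} → LowerBound n x → LowerBound (k ℕ.+ n) x
  LowerBound-+ zero    bound     = bound
  LowerBound-+ (suc k) bound s c = average-≥ letters λ ε → LowerBound-+ k bound (next s ε) (c - label s ε)

  -- A random word begins with `l` with probability `r ^ length l`, and then the gain `g` is
  -- realised; every other beginning still keeps the bound `x`. The centre `c - out s l` is what is
  -- left of `c` after reading `l`.
  gain-along : ∀ l {n x g} s c → LowerBound n x → x + g ≤ M n (run s l) (c - out s l) →
    x + g * r ^ length l ≤ M (length l ℕ.+ n) s c
  gain-along []      {n} s c bound gain = ≤-respˡ-≈ (+-congˡ (sym (*-identityʳ _)))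
    (≤-respʳ-≈ (M-cong n s (trans (+-congˡ -0#≈0#) (+-identityʳ c))) gain)
  gain-along (ε ∷ l) {n} {x} {g} s c bound gain = ≤-respˡ-≈
    (+-congˡ (solve 3 (λ g p r → g :* p :* r := g :* (r :* p)) refl g (r ^ length l) r))
    (average-≥-gain (λ ε → LowerBound-+ (length l) bound (next s ε) (c - label s ε)) (∈-allFin ε)
      (gain-along l (next s ε) (c - label s ε) bound (≤-respʳ-≈ (M-cong n _
        (solve 3 (λ c d o → c :- (d :+ o) := c :- d :- o) refl c (label s ε) (out (next s ε) l))) gain)))

  r^-nonNegative : ∀ n → 0# ≤ r ^ n
  r^-nonNegative zero    = 0≤1
  r^-nonNegative (suc n) = *-nonNegative (fromℕ-⁻¹-nonNegative (length letters)) (r^-nonNegative n)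

  r^-antitone : ∀ d n → r ^ (d ℕ.+ n) ≤ r ^ n
  r^-antitone zero    n = ≤-refl
  r^-antitone (suc d) n = ≤-trans (≤-respʳ-≈ (*-identityˡ _)
    (*-monoʳ-≤ (r^-nonNegative (d ℕ.+ n)) (fromℕ-⁻¹≤1 (length letters)))) (r^-antitone d n)

  r^n*x≈0⇒x≈0 : ∀ n {x} → x * r ^ n ≈ 0# → x ≈ 0#
  r^n*x≈0⇒x≈0 zero    x*1≈0    = trans (sym (*-identityʳ _)) x*1≈0
  r^n*x≈0⇒x≈0 (suc n) {x} x*r*rⁿ≈0 = r^n*x≈0⇒x≈0 n (begin
    x * r ^ n                                         ≈⟨ *-identityʳ _ ⟨
    x * r ^ n * 1#                                    ≈⟨ *-congˡ (*-inverseʳ (fromℕ≉0 (length letters))) ⟨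
    x * r ^ n * (fromℕ (length letters) * r)          ≈⟨ solve 4 (λ x p k r → x :* p :* (k :* r) := x :* (r :* p) :* k) refl x (r ^ n) _ r ⟩
    x * (r * r ^ n) * fromℕ (length letters)          ≈⟨ *-congʳ x*r*rⁿ≈0 ⟩
    0# * fromℕ (length letters)                       ≈⟨ zeroˡ _ ⟩
    0#                                                ∎)
    where open import Relation.Binary.Reasoning.Setoid setoid

  gain-along-twice : ∀ l {s n x g} c → run s l ≡ s → LowerBound n x →
    x + g ≤ M n s (c - (out s l + out s l)) →
    x + g * r ^ (length l ℕ.+ length l) ≤ M (length l ℕ.+ length l ℕ.+ n) s c
  gain-along-twice l {s} {n} {x} {g} c loop bound gain =
    ≡.subst (λ N → x + g * r ^ N ≤ M (N ℕ.+ n) s c) (length-++ l)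
      (gain-along (l ++ l) s c bound
        (≡.subst (λ t → x + g ≤ M n t (c - out s (l ++ l))) (≡.sym loops)
          (≤-respʳ-≈ (M-cong n s (+-congˡ (-‿cong (sym outs)))) gain)))
    where
    loops : run s (l ++ l) ≡ s
    loops = ≡.trans (run-++ s l l) (≡.trans (≡.cong (λ t → run t l) loop) loop)
    outs : out s (l ++ l) ≈ out s l + out s l
    outs = trans (out-++ s l l) (+-congˡ (reflexive (≡.cong (λ t → out t l) loop)))

  -- The same `N` and `g` serve every bound already reached, which later allows the gain to be
  -- collected repeatedly.
  GainAt : State → ℕ → Carrier → Set
  GainAt s N g = ∀ {n x} → LowerBound n x → ∀ c → x + g ≤ M (N ℕ.+ n) s c

  -- With h the difference of the outputs of l and l′, the outputs of l l and
  -- l′ l′ lie at distance h on either side of their mean, which makes the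
  -- parallelogram identity applicable.
  gain-at-loop : ∀ {s} l l′ → run s l ≡ s → run s l′ ≡ s → length l ≡ length l′ →
    let h = out s l′ - out s l; N = length l ℕ.+ length l in GainAt s N (h * h * r ^ N)
  gain-at-loop {s} l l′ loop loop′ same {n} {x} bound c with either-≤ sum-≥
    where
    o o′ h : Carrier
    o  = out s l
    o′ = out s l′
    h  = o′ - o
    sum-≥ : x + h * h + (x + h * h) ≤ M n s (c - (o + o)) + M n s (c - (o′ + o′))
    sum-≥ = ≤-respˡ-≈ (solve 2 (λ x y → x :+ x :+ (y :+ y) := x :+ y :+ (x :+ y)) refl x (h * h))
      (≤-respʳ-≈ (trans (sym (M-parallelogram n s (c - (o + o′)) h))
        (+-cong (M-cong n s (solve 3 (λ c o p → c :- (o :+ p) :+ (p :- o) := c :- (o :+ o)) refl c o o′))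
                (M-cong n s (solve 3 (λ c o p → c :- (o :+ p) :- (p :- o) := c :- (p :+ p)) refl c o o′))))
        (+-monoˡ-≤ (h * h + h * h) (+-mono-≤ (bound s (c - (o + o′))) (bound s (c - (o + o′))))))
  ... | inj₁ gain = gain-along-twice l c loop bound gain
  ... | inj₂ gain = ≡.subst
    (λ N → x + (out s l′ - out s l) * (out s l′ - out s l) * r ^ (N ℕ.+ N) ≤ M (N ℕ.+ N ℕ.+ n) s c)
    (≡.sym same) (gain-along-twice l′ c loop′ bound gain)

  UniformGain : ℕ → Carrier → Set
  UniformGain N g = ∀ {n x} → LowerBound n x → LowerBound (N ℕ.+ n) (x + g)

  -- From any state, first follow the route to `t` and then collect the gain there. The finitely
  -- many routes have lengths at most `K`, so at least the fraction `r ^ K` of the gain arrives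
  -- everywhere.
  spread-gain : ∀ {t N g} → (∀ s → ∃ λ l → run s l ≡ t) → 0# ≤ g → GainAt t N g →
    ∃ λ K → UniformGain (K ℕ.+ N) (g * r ^ K)
  spread-gain {t} {N} {g} route 0≤g gain with finite-bound ℕ.≤-totalOrder (λ s → length (proj₁ (route s)))
  ... | K , length≤K = K , gain-from
    where
    gain-from : UniformGain (K ℕ.+ N) (g * r ^ K)
    gain-from {n} {x} bound s c with route s | length≤K s
    ... | l , run-l≡t | length-l≤K = ≤-trans
      (+-monoʳ-≤ x (≤-respˡ-≈ (*-comm _ _) (≤-respʳ-≈ (*-comm _ _) (*-monoʳ-≤ 0≤g
        (≡.subst (λ k → r ^ k ≤ r ^ length l) (ℕ.m∸n+n≡m length-l≤K) (r^-antitone d (length l)))))))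
      (≡.subst (λ k → x + g * r ^ length l ≤ M k s c) lengths
        (gain-along l s c (LowerBound-+ N (LowerBound-+ d bound))
          (≡.subst (λ u → x + g ≤ M (N ℕ.+ (d ℕ.+ n)) u (c - out s l)) (≡.sym run-l≡t)
            (gain (LowerBound-+ d bound) (c - out s l)))))
      where
      -- The letters saved by a short route are spent after the gain at `t`, where `LowerBound-+`
      -- keeps the bound; so all states need the same total length `K + N`.
      d : ℕ
      d = K ℕ.∸ length l
      rearrange : ∀ l N d n → l ℕ.+ (N ℕ.+ (d ℕ.+ n)) ≡ d ℕ.+ l ℕ.+ N ℕ.+ n
      rearrange = solve-∀
      open ≡.≡-Reasoning
      lengths : length l ℕ.+ (N ℕ.+ (d ℕ.+ n)) ≡ K ℕ.+ N ℕ.+ n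
      lengths = begin
        length l ℕ.+ (N ℕ.+ (d ℕ.+ n))   ≡⟨ rearrange (length l) N d n ⟩
        d ℕ.+ length l ℕ.+ N ℕ.+ n       ≡⟨ ≡.cong (λ k → k ℕ.+ N ℕ.+ n) (ℕ.m∸n+n≡m length-l≤K) ⟩
        K ℕ.+ N ℕ.+ n                    ∎

  -- Linear growth of the lower bound, which a bounded variance excludes for positive `g`.
  iterate-gain : ∀ {N g} → UniformGain N g → ∀ j → LowerBound (j ℕ.* N) (fromℕ j * g)
  iterate-gain gain zero    s c = ≤-respˡ-≈ (sym (zeroˡ _)) (LowerBound-zero s c)
  iterate-gain {g = g} gain (suc j) s c = ≤-respˡ-≈
    (trans (+-comm _ _) (trans (+-congʳ (sym (*-identityˡ g))) (sym (distribʳ g 1# (fromℕ j)))))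
    (gain (iterate-gain gain j) s c)

  -- Variance of the output as a second moment.

  words : ∀ n → List (Word n)
  words = allWords 𝓣 subsequential complete

  endState : ∀ {n} → Word n → State
  endState w = proj₁ (path 𝓣 subsequential complete w)

  labelSum : ∀ {n} → Word n → Carrier
  labelSum w = sum (outputLabels 𝓣 subsequential complete (proj₂ (path 𝓣 subsequential complete w)))

  -- Since `path` is defined by nested matches, its value at a longer word does not unfold by
  -- itself. Repeating the matches under a property of end state and label sum together makes both
  -- sides the same.
  path-∷ : ∀ {n} ε (w : Word n) {ℓ} (P : State → Carrier → Set ℓ) →
    P (next (endState w) ε) (label (endState w) ε + labelSum w) → P (endState (ε Vec.∷ w)) (labelSum (ε Vec.∷ w))
  path-∷ ε w P with path 𝓣 subsequential complete w
  ... | s , p with complete s ε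
  ...   | t , e = λ z → z

  length-letters : length letters ≡ q
  length-letters = length-tabulate {n = q} (λ i → i)

  length-words : ∀ n → length (words n) ≡ q ℕ.^ n
  length-words zero    = ≡.refl
  length-words (suc n) = ≡.trans (length-cartesianProductWith Vec._∷_ letters (words n))
    (≡.cong₂ ℕ._*_ length-letters (length-words n))

  instance
    words-nonempty : ∀ {n} → ℕ.NonZero (length (words n))
    words-nonempty {n} = ≡.subst ℕ.NonZero (≡.sym (length-words n))
      (ℕ.m^n≢0 q n {{≡.subst ℕ.NonZero length-letters letters-nonempty}})

  𝔼-average : ∀ {n} (f : Word n → Carrier) → 𝔼 𝓣 subsequential complete f ≈ average (words n) f
  𝔼-average {n} f = reflexive (≡.cong (λ k → ∑ (words n) f * fromℕ k ⁻¹) (≡.sym (length-words n)))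

  -- Here `n` letters have been read along a path and `m` remain to be averaged by `M`. The head of
  -- a word is the letter read last, so the induction hands letters from the head of the word over
  -- to `M`. The case `m = 0` yields the variance.
  average-M : ∀ n m c → average (words n) (λ w → M m (endState w) (c - labelSum w)) ≈ M (n ℕ.+ m) initial c
  average-M zero m c = trans
    (average-cong {f = λ w → M m (endState w) (c - labelSum w)} {g = λ _ → M m initial c} (words 0)
      λ { Vec.[] → M-cong m initial (trans (+-congˡ -0#≈0#) (+-identityʳ c)) })
    (average-const (M m initial c) (words 0))
  average-M (suc n) m c = begin
    average (words (suc n)) (λ w → M m (endState w) (c - labelSum w))
      ≈⟨ average-cartesianProductWith _ Vec._∷_ letters (words n) {{letters-nonempty}} {{words-nonempty {n}}} ⟩
    average letters (λ ε → average (words n) (λ w → M m (endState (ε Vec.∷ w)) (c - labelSum (ε Vec.∷ w))))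
      -- With the head letter averaged innermost, the inner average is one unfolding of `M (suc m)`.
      ≈⟨ average-swap _ letters (words n) ⟩
    average (words n) (λ w → average letters (λ ε → M m (endState (ε Vec.∷ w)) (c - labelSum (ε Vec.∷ w))))
      ≈⟨ average-cong (words n) (λ w → average-cong letters (λ ε → peel w ε)) ⟩
    average (words n) (λ w → M (suc m) (endState w) (c - labelSum w))
      ≈⟨ average-M n (suc m) c ⟩
    M (n ℕ.+ suc m) initial c
      ≡⟨ ≡.cong (λ k → M k initial c) (ℕ.+-suc n m) ⟩
    M (suc n ℕ.+ m) initial c  ∎
    where
    open import Relation.Binary.Reasoning.Setoid setoid
    peel : ∀ w ε → M m (endState (ε Vec.∷ w)) (c - labelSum (ε Vec.∷ w)) ≈
                   M m (next (endState w) ε) (c - labelSum w - label (endState w) ε)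
    peel w ε = path-∷ ε w (λ s o → M m s (c - o) ≈ M m (next (endState w) ε) (c - labelSum w - label (endState w) ε))
      (M-cong m _ (solve 3 (λ c d o → c :- (d :+ o) := c :- o :- d) refl c (label (endState w) ε) (labelSum w)))

  output : ∀ {n} → Word n → Carrier
  output = Output 𝓣 subsequential complete

  mean variance : ℕ → Carrier
  mean     n = 𝔼 𝓣 subsequential complete (output {n})
  variance n = 𝕍 𝓣 subsequential complete (output {n})

  variance≈M : ∀ n → variance n ≈ M n initial (mean n)
  variance≈M n = begin
    variance n                                                       ≈⟨ 𝔼-average {n} _ ⟩
    average (words n) (λ w → (output w - mean n) * (output w - mean n)) ≈⟨ average-cong (words n) (λ w →
      solve 3 (λ x o e → (x :+ o :- e) :* (x :+ o :- e) := (x :- (e :- o)) :* (x :- (e :- o))) refl (a (endState w)) (labelSum w) (mean n)) ⟩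
    average (words n) (λ w → M 0 (endState w) (mean n - labelSum w)) ≈⟨ average-M n 0 (mean n) ⟩
    M (n ℕ.+ 0) initial (mean n)                                     ≡⟨ ≡.cong (λ k → M k initial (mean n)) (ℕ.+-identityʳ n) ⟩
    M n initial (mean n)                                             ∎
    where open import Relation.Binary.Reasoning.Setoid setoid

  -- Words are read from the right, whereas `run` consumes its list from the left.
  reading : ∀ {n} → Word n → List (Fin q)
  reading w = reverse (Vec.toList w)

  length-reading : ∀ {n} (w : Word n) → length (reading w) ≡ n
  length-reading w = ≡.trans (length-reverse (Vec.toList w)) (Vec.length-toList w)

  path-run : ∀ {n} (w : Word n) → run initial (reading w) ≡ endState w × out initial (reading w) ≈ labelSum w
  path-run Vec.[]      = ≡.refl , refl
  path-run (ε Vec.∷ w) = path-∷ ε w (λ s o → run initial (reading (ε Vec.∷ w)) ≡ s × out initial (reading (ε Vec.∷ w)) ≈ o)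
    (≡.subst (λ l → run initial l ≡ next (endState w) ε × out initial l ≈ label (endState w) ε + labelSum w)
      (≡.sym (unfold-reverse ε (Vec.toList w))) (snoc (path-run w)))
    where
    snoc : ∀ {s o} → run initial (reading w) ≡ s × out initial (reading w) ≈ o →
      run initial (reading w ++ ε ∷ []) ≡ next s ε × out initial (reading w ++ ε ∷ []) ≈ label s ε + o
    snoc {o = o} (≡.refl , out≈o) = run-++ initial (reading w) (ε ∷ []) , trans (out-++ initial (reading w) (ε ∷ []))
      (trans (+-cong out≈o (+-identityʳ _)) (+-comm o _))

  variance-nonNegative : ∀ n → 0# ≤ variance n
  variance-nonNegative n = ≤-respʳ-≈ (sym (𝔼-average {n} _))
    (average-≥ (words n) {{words-nonempty {n}}} λ w → square-nonNegative (output w - mean n))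

  -- Each output lies within `B` of `k * fromℕ n`, hence so does the mean, and the two differ by at
  -- most `B + B`.
  variance≤4B² : ∀ {k B} → (∀ n (w : Word n) → ∣ output w - k * fromℕ n ∣ ≤ B) →
    ∀ n → variance n ≤ (B + B) * (B + B)
  variance≤4B² {k} {B} near n = ≤-respˡ-≈ (sym (𝔼-average {n} _))
    (average-≤ (words n) {{words-nonempty {n}}} λ w → square-mono-≤
      (≤-by-difference (+-nonNegative (difference-nonNegative (above w)) (difference-nonNegative mean-≥))
        (solve 4 (λ x e c b → c :+ b :- x :+ (e :- (c :- b)) :+ (x :- e) := b :+ b) refl (output w) (mean n) (k * fromℕ n) B))
      (≤-by-difference (+-nonNegative (difference-nonNegative (below w)) (difference-nonNegative mean-≤))
        (solve 4 (λ x e c b → x :- (c :- b) :+ (c :+ b :- e) :+ (:- (b :+ b)) := x :- e) refl (output w) (mean n) (k * fromℕ n) B)))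
    where
    above : ∀ w → output w ≤ k * fromℕ n + B
    above w = ≤-by-difference (difference-nonNegative (∣x∣≤c⇒x≤c (near n w)))
      (solve 3 (λ x c b → b :- (x :- c) :+ x := c :+ b) refl (output w) (k * fromℕ n) B)
    below : ∀ w → k * fromℕ n - B ≤ output w
    below w = ≤-by-difference (difference-nonNegative (∣x∣≤c⇒-c≤x (near n w)))
      (solve 3 (λ x c b → x :- c :- (:- b) :+ (c :- b) := x) refl (output w) (k * fromℕ n) B)
    mean-≤ : mean n ≤ k * fromℕ n + B
    mean-≤ = ≤-respˡ-≈ (sym (𝔼-average {n} _)) (average-≤ (words n) {{words-nonempty {n}}} above)
    mean-≥ : k * fromℕ n - B ≤ mean n
    mean-≥ = ≤-respʳ-≈ (sym (𝔼-average {n} _)) (average-≥ (words n) {{words-nonempty {n}}} below)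

  -- From bounded variance to quasi-determinism.

  module BoundedVariance (connected : StronglyConnected) {C} (variance≤C : ∀ n → variance n ≤ C) where

    toInitial : ∀ s → ∃ λ l → run s l ≡ initial
    toInitial s = Walk⇒run (proj₂ (connected s initial))

    -- The gain obtained from the output difference `h`, spread to all states and iterated, has all
    -- its multiples bounded by `C`. It is therefore both nonpositive and nonnegative, and
    -- cancelling the powers of `r` leaves `h * h ≈ 0#`.
    loops-agree : ∀ l l′ → run initial l ≡ initial → run initial l′ ≡ initial → length l ≡ length l′ →
      out initial l ≈ out initial l′
    loops-agree l l′ loop loop′ same = sym (begin
      out initial l′                              ≈⟨ solve 2 (λ x y → y := y :- x :+ x) refl (out initial l) (out initial l′) ⟩
      h + out initial l                           ≈⟨ +-congʳ (x*x≈0⇒x≈0 (r^n*x≈0⇒x≈0 N (r^n*x≈0⇒x≈0 K (antisym gain≤0 0≤gain)))) ⟩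
      0# + out initial l                          ≈⟨ +-identityˡ _ ⟩
      out initial l                               ∎)
      where
      open import Relation.Binary.Reasoning.Setoid setoid
      h : Carrier
      h = out initial l′ - out initial l
      N : ℕ
      N = length l ℕ.+ length l
      0≤h²rᴺ : 0# ≤ h * h * r ^ N
      0≤h²rᴺ = *-nonNegative (square-nonNegative h) (r^-nonNegative N)
      spread : ∃ λ K → UniformGain (K ℕ.+ N) (h * h * r ^ N * r ^ K)
      spread = spread-gain toInitial 0≤h²rᴺ (gain-at-loop l l′ loop loop′ same)
      K : ℕ
      K = proj₁ spread
      0≤gain : 0# ≤ h * h * r ^ N * r ^ K
      0≤gain = *-nonNegative 0≤h²rᴺ (r^-nonNegative K)
      gain≤0 : h * h * r ^ N * r ^ K ≤ 0#
      -- The lower bound holds about every centre; about the mean it bounds the variance from below.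
      gain≤0 = archimedean λ j → ≤-trans (iterate-gain (proj₂ spread) j initial (mean (j ℕ.* (K ℕ.+ N))))
        (≤-respˡ-≈ (variance≈M (j ℕ.* (K ℕ.+ N))) (variance≤C (j ℕ.* (K ℕ.+ N))))

    -- A reference loop whose output per letter is `k`. The extra first letter makes its length
    -- nonzero, as the return walk alone might be empty.
    base : List (Fin q)
    base = ε ∷ proj₁ (toInitial (next initial ε))
      where
      ε : Fin q
      ε = fromℕ< (ℕ.≤-trans (ℕ.s≤s ℕ.z≤n) 2≤q)

    base-loop : run initial base ≡ initial
    base-loop = proj₂ (toInitial _)

    k : Carrier
    k = out initial base * fromℕ (length base) ⁻¹

    -- Repeating `l` as often as `base` has letters, and `base` as often as `l` has letters, gives
    -- two loops of equal length, whose outputs agree.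
    loop-output : ∀ l → run initial l ≡ initial → out initial l ≈ k * fromℕ (length l)
    loop-output l loop = *-cancelʳ-≈ (fromℕ≉0 (length base)) (begin
      out initial l * fromℕ (length base)               ≈⟨ *-comm _ _ ⟩
      fromℕ (length base) * out initial l               ≈⟨ out-power (length base) l loop ⟨
      out initial (power (length base) l)               ≈⟨ loops-agree (power (length base) l) (power (length l) base)
                                                          (run-power (length base) l loop) (run-power (length l) base base-loop)
                                                          (≡.trans (length-power (length base) l)
                                                            (≡.trans (ℕ.*-comm (length base) (length l)) (≡.sym (length-power (length l) base)))) ⟩
      out initial (power (length l) base)               ≈⟨ out-power (length l) base base-loop ⟩
      fromℕ (length l) * out initial base               ≈⟨ *-identityʳ _ ⟨
      fromℕ (length l) * out initial base * 1#          ≈⟨ *-congˡ (*-inverseʳ (fromℕ≉0 (length base))) ⟨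
      fromℕ (length l) * out initial base * (fromℕ (length base) * fromℕ (length base) ⁻¹)
        ≈⟨ solve 4 (λ n o m u → n :* o :* (m :* u) := o :* u :* n :* m) refl
             (fromℕ (length l)) (out initial base) (fromℕ (length base)) (fromℕ (length base) ⁻¹) ⟩
      out initial base * fromℕ (length base) ⁻¹ * fromℕ (length l) * fromℕ (length base)   ∎)
      where open import Relation.Binary.Reasoning.Setoid setoid

    -- Closing a path of length `n` by a return walk of length `m` gives a loop with output `k`
    -- times `n + m`. What remains of the output after subtracting `k` times `n` thus depends on the
    -- end state only and takes finitely many values.
    deviation : State → Carrier
    deviation s = a s - out s (proj₁ (toInitial s)) + k * fromℕ (length (proj₁ (toInitial s)))

    output-deviation : ∀ {n} (w : Word n) → output w - k * fromℕ n ≈ deviation (endState w)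
    output-deviation {n} w with endState w | labelSum w | path-run w
    ... | s | o | run≡s , out≈o = begin
      a s + o - k * fromℕ n                              ≈⟨ solve 4 (λ x o c y → x :+ o :- c := x :- y :+ (o :+ y :- c)) refl
                                                              (a s) o (k * fromℕ n) y ⟩
      a s - y + (o + y - k * fromℕ n)                    ≈⟨ +-congˡ (+-congʳ closed) ⟩
      a s - y + (k * (fromℕ n + fromℕ m) - k * fromℕ n)  ≈⟨ +-congˡ (solve 3 (λ k n m → k :* (n :+ m) :- k :* n := k :* m) refl k (fromℕ n) (fromℕ m)) ⟩
      a s - y + k * fromℕ m                              ∎
      where
      open import Relation.Binary.Reasoning.Setoid setoid
      l l′ : List (Fin q)
      l  = reading w
      l′ = proj₁ (toInitial s)
      m : ℕ
      m = length l′
      y : Carrier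
      y = out s l′
      closed : o + y ≈ k * (fromℕ n + fromℕ m)
      closed = begin
        o + y                                    ≈⟨ +-congʳ out≈o ⟨
        out initial l + out s l′                 ≡⟨ ≡.cong (λ t → out initial l + out t l′) run≡s ⟨
        out initial l + out (run initial l) l′   ≈⟨ out-++ initial l l′ ⟨
        out initial (l ++ l′)                    ≈⟨ loop-output (l ++ l′) (≡.trans (run-++ initial l l′)
                                                      (≡.trans (≡.cong (λ t → run t l′) run≡s) (proj₂ (toInitial s)))) ⟩
        k * fromℕ (length (l ++ l′))             ≡⟨ ≡.cong (λ i → k * fromℕ i) (≡.trans (length-++ l) (≡.cong (ℕ._+ m) (length-reading w))) ⟩
        k * fromℕ (n ℕ.+ m)                      ≈⟨ *-congˡ (fromℕ-+ n m) ⟩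
        k * (fromℕ n + fromℕ m)                  ∎

    quasiDeterministic : QuasiDeterministic 𝓣 subsequential complete
    quasiDeterministic with finite-bound ≤-totalOrder (λ s → ∣ deviation s ∣)
    ... | B , ∣deviation∣≤B = k , B , λ n w → ≤-respˡ-≈ (∣-∣-cong (sym (output-deviation w))) (∣deviation∣≤B (endState w))

corollary3p4 : (𝓡 : RealField) (𝓣 : Transducer 𝓡)
    (subsequential : Transducer.Subsequential 𝓣)
    (complete : Transducer.Complete 𝓣) →
    Transducer.StronglyConnected 𝓣 →
    Transducer.Aperiodic 𝓣 →
    (v₂ : RealField.Carrier 𝓡) →
    IsAsymptoticVariance 𝓣 subsequential complete v₂ →
    (RealField._≈_ 𝓡 v₂ (RealField.0# 𝓡)) ⇔ QuasiDeterministic 𝓣 subsequential complete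
corollary3p4 𝓡 𝓣 subsequential complete connected _ v₂ (C , v₂-asymptotic) = mk⇔ zero⇒quasi quasi⇒zero
  where
  open RealField 𝓡
  open RealFieldProperties 𝓡
  open CompleteTransducer 𝓣 subsequential complete

  zero⇒quasi : v₂ ≈ 0# → QuasiDeterministic 𝓣 subsequential complete
  zero⇒quasi v₂≈0 = BoundedVariance.quasiDeterministic connected λ n → ≤-respˡ-≈
    (begin
      variance n - v₂ * fromℕ n   ≈⟨ +-congˡ (-‿cong (trans (*-congʳ v₂≈0) (zeroˡ _))) ⟩
      variance n - 0#             ≈⟨ +-congˡ -0#≈0# ⟩
      variance n + 0#             ≈⟨ +-identityʳ _ ⟩
      variance n                  ∎)
    (∣x∣≤c⇒x≤c (v₂-asymptotic n))
    where open import Relation.Binary.Reasoning.Setoid setoid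

  quasi⇒zero : QuasiDeterministic 𝓣 subsequential complete → v₂ ≈ 0#
  -- For the first inequality, `v₂ * fromℕ n` is at most the variance plus `C`, and the variance is
  -- bounded. For the second, it is at least the variance minus `C`, and the variance is
  -- nonnegative.
  quasi⇒zero (k , B , near) = antisym
    (archimedean λ n → ≤-by-difference
      (+-nonNegative (difference-nonNegative (∣x∣≤c⇒-c≤x (v₂-asymptotic n)))
                     (difference-nonNegative (variance≤4B² near n)))
      (solve 5 (λ V v n C D → V :- v :* n :- (:- C) :+ (D :- V) :+ n :* v := D :+ C) refl
        (variance n) v₂ (fromℕ n) C ((B + B) * (B + B))))
    (≤-respʳ-≈ (-‿involutive v₂) (≤-respˡ-≈ -0#≈0# (neg-anti-≤
      (archimedean λ n → ≤-by-difference
        (+-nonNegative (difference-nonNegative (∣x∣≤c⇒x≤c (v₂-asymptotic n))) (variance-nonNegative n))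
        (solve 4 (λ V v n C → C :- (V :- v :* n) :+ V :+ n :* (:- v) := C) refl
          (variance n) v₂ (fromℕ n) C)))))
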